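{- Let $w$ be an overlap-free binary word, and suppose $w = S_1 S_2 \cdots S_k$ where each $S_i$ is a square. Then $k + L(w) + R(w) \leq 9$.
   Context: A square is a word of the form $xx$ with $x$ a nonempty word. An overlap is a word of the form $axaxa$ where $a$ is a single letter and $x$ a possibly empty word; a word is overlap-free if none of its factors (contiguous subwords) is an overlap. For a binary word $w$, $L(w) = 1$ if there exists $a \in \{0,1\}$ such that $aw$ is overlap-free and $L(w) = 0$ otherwise; $R(w) = 1$ if there exists $a \in \{0,1\}$ such that $wa$ is overlap-free and $R(w) = 0$ otherwise. -}

module Defs where

open import Data.Bool using (Bool)
open import Data.List using (List; []; _∷_; _++_; [_]; concat; length)
open import Data.List.Relation.Unary.All using (All)
open import Data.Nat using (ℕ)
open import Data.Product using (∃; ∃-syntax; Σ-syntax; _×_)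
open import Relation.Nullary using (¬_)
open import Relation.Binary.PropositionalEquality using (_≡_)

Word : Set
Word = List Bool

Factor : Word → Word → Set
Factor f w = ∃[ u ] ∃[ v ] (w ≡ u ++ f ++ v)

Square : Word → Set
Square s = ∃[ x ] (¬ (x ≡ []) × s ≡ x ++ x)

Overlap : Word → Set
Overlap f = ∃[ a ] ∃[ x ] (f ≡ a ∷ x ++ a ∷ x ++ [ a ])

OverlapFree : Word → Set
OverlapFree w = ∀ f → Factor f w → ¬ Overlap f

data HasL (w : Word) : ℕ → Set where
  L-one  : ∃[ a ] OverlapFree (a ∷ w) → HasL w 1
  L-zero : ¬ (∃[ a ] OverlapFree (a ∷ w)) → HasL w 0

data HasR (w : Word) : ℕ → Set where
  R-one  : ∃[ a ] OverlapFree (w ++ [ a ]) → HasR w 1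
  R-zero : ¬ (∃[ a ] OverlapFree (w ++ [ a ])) → HasR w 0

{-# OPTIONS --safe #-}

-- Letters at both ends of w forbid the factors 00100 and 11011 in w, and then
-- all occurrences of 00 and 11 in w start at positions of the same parity.
-- Hence either w = μ(v) for the Thue–Morse morphism μ, or w = c μ(v) d.
-- In the first case a factorisation of w into squares is the image of one of v,
-- and extendability passes from w to v, so one descends.
-- In the second case each of the squares must be 00, 11, 010010 or 101101,
-- and a finite search shows that at most seven of them can follow each other.
-- Squares at the ends of w play the role of missing extensions, so it is
-- enough to exclude eight squares in a word that extends on both sides.

module Submission where

open import Defs
open import Data.Bool using (Bool; true; false; not)
open import Data.Bool.Properties using (not-involutive) renaming (_≟_ to _≟ᵇ_)
open import Data.Empty using (⊥; ⊥-elim)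
open import Data.List using (List; []; _∷_; _++_; [_]; _∷ʳ_; concat; length; take; drop; upTo; filter; cartesianProductWith; initLast; _∷ʳ′_)
open import Data.List.Membership.Propositional using (_∈_)
open import Data.List.Membership.Propositional.Properties using (∈-filter⁺; ∈-cartesianProductWith⁺)
open import Data.List.Properties using (++-assoc; ++-identityʳ; ∷-injective; ∷-injectiveʳ; ∷ʳ-injectiveˡ; length-++; concat-++)
open import Data.List.Relation.Binary.Pointwise using (Pointwise-≡⇒≡)
open import Data.List.Relation.Binary.Prefix.Heterogeneous using (Prefix; toView) renaming (_++_ to _++ᵖ_)
open import Data.List.Relation.Binary.Prefix.Heterogeneous.Properties using (prefix?)
open import Data.List.Relation.Unary.All using (All; []; _∷_)
open import Data.List.Relation.Unary.All.Properties using (∷ʳ⁻)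
open import Data.List.Relation.Unary.Any using (Any; here; there; any?; satisfied)
open import Data.Nat using (ℕ; zero; suc; _+_; _∸_; ⌊_/2⌋; _≤_; _<_; _≤?_; z≤n; s≤s)
open import Data.Nat.Properties using (≤-trans; ≤-refl; m∸n+n≡m; m≤n⇒m≤1+n; ≰⇒>; ≤-pred; +-comm; +-monoˡ-≤)
open import Data.Product using (∃₂; ∃-syntax; _×_; _,_; proj₁; proj₂)
open import Data.Sum using (_⊎_; inj₁; inj₂)
open import Function using (_∘_)
open import Relation.Binary.PropositionalEquality using (_≡_; refl; sym; trans; cong; cong₂; subst; module ≡-Reasoning)
open import Relation.Nullary using (¬_; Dec; yes; no)
open import Relation.Nullary.Decidable using (_⊎-dec_; ¬?)

private
  variable
    a b c d e : Bool
    v w x y z : Word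
    ss : List Word

-- Overlaps and factors

axaxa : Bool → Word → Word
axaxa a x = a ∷ x ++ a ∷ x ++ [ a ]

axaxa-++ : ∀ a x v → axaxa a x ++ v ≡ a ∷ x ++ a ∷ x ++ a ∷ v
axaxa-++ a x v = cong (a ∷_)
  (trans (++-assoc x _ v) (cong (λ t → x ++ a ∷ t) (++-assoc x [ a ] v)))

-- The right-nested form lets `refl` prove the equation whenever the offending letters are explicit,
-- as in the case analyses below.
overlap⇒⊥ : OverlapFree w → ∀ u a x v → w ≡ u ++ a ∷ x ++ a ∷ x ++ a ∷ v → ⊥
overlap⇒⊥ of u a x v eq =
  of (axaxa a x) (u , v , trans eq (cong (u ++_) (sym (axaxa-++ a x v)))) (a , x , refl)

of-suffix : ∀ u → OverlapFree (u ++ w) → OverlapFree w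
of-suffix u of f (u′ , v , eq) =
  of f (u ++ u′ , v , trans (cong (u ++_) eq) (sym (++-assoc u u′ _)))

of-prefix : ∀ w → OverlapFree (w ++ v) → OverlapFree w
of-prefix {v} w of f (u , v′ , eq) = of f (u , v′ ++ v , (begin
  w ++ v               ≡⟨ cong (_++ v) eq ⟩
  (u ++ f ++ v′) ++ v  ≡⟨ ++-assoc u (f ++ v′) v ⟩
  u ++ (f ++ v′) ++ v  ≡⟨ cong (u ++_) (++-assoc f v′ v) ⟩
  u ++ f ++ v′ ++ v    ∎))
  where open ≡-Reasoning

of-tail : OverlapFree (c ∷ w) → OverlapFree w
of-tail {c} = of-suffix [ c ]

-- Words of even length

data Even : Word → Set where
  []  : Even []
  2+_ : Even w → Even (c ∷ d ∷ w)

data Parity : Word → Set where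
  even : Even w → Parity w
  odd  : Even w → Parity (c ∷ w)

parity : ∀ w → Parity w
parity [] = even []
parity (c ∷ w) with parity w
... | even p = odd p
... | odd p  = even (2+ p)

even-++ : Even x → Even y → Even (x ++ y)
even-++ []     q = q
even-++ (2+ p) q = 2+ even-++ p q

odd-++-odd : Even x → Even y → Even (c ∷ x ++ d ∷ y)
odd-++-odd []     q = 2+ q
odd-++-odd (2+ p) q = 2+ odd-++-odd p q

even-cancelˡ : Even x → Even (x ++ y) → Even y
even-cancelˡ []     q      = q
even-cancelˡ (2+ p) (2+ q) = even-cancelˡ p q

even-xx : ∀ x → Even (x ++ x)
even-xx x with parity x
... | even p = even-++ p p
... | odd p  = odd-++-odd p p

even-concat : All Square ss → Even (concat ss)
even-concat []                     = []
even-concat ((x , _ , refl) ∷ sqs) = even-++ (even-xx x) (even-concat sqs)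

¬even-axaxa : ∀ a x → ¬ Even (axaxa a x)
¬even-axaxa a x p
  with () ← even-cancelˡ (even-xx (a ∷ x)) (subst Even (sym (++-assoc (a ∷ x) (a ∷ x) [ a ])) p)

-- The only factor of awb inside neither aw nor wb is awb itself, whose length
-- is even, while overlaps have odd length.
of-extend : Even w → OverlapFree (a ∷ w) → OverlapFree (w ++ [ b ]) → OverlapFree (a ∷ w ++ [ b ])
of-extend p ofˡ ofʳ f (_ ∷ u , v , eq) o = ofʳ f (u , v , ∷-injectiveʳ eq) o
of-extend {w} {a} {b} p ofˡ ofʳ f ([] , v , eq) o@(c , x , refl) with initLast v
... | [] = ¬even-axaxa c x
  (subst Even (trans eq (++-identityʳ f)) (odd-++-odd p []))
... | v′ ∷ʳ′ b′ = ofˡ f ([] , v′ , ∷ʳ-injectiveˡ (a ∷ w) (f ++ v′) (trans eq (sym (++-assoc f v′ [ b′ ])))) o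

snoc-view : ∀ c (w : Word) → ∃₂ λ t e → c ∷ w ≡ t ++ [ e ]
snoc-view c []      = [] , c , refl
snoc-view c (d ∷ w) with t , e , eq ← snoc-view d w = c ∷ t , e , cong (c ∷_) eq

-- The Thue–Morse morphism

μ : Word → Word
μ []      = []
μ (c ∷ w) = c ∷ not c ∷ μ w

μ-++ : ∀ x y → μ (x ++ y) ≡ μ x ++ μ y
μ-++ []      y = refl
μ-++ (c ∷ x) y = cong (λ t → c ∷ not c ∷ t) (μ-++ x y)

μ-repeat : ∀ x c v → μ (x ++ c ∷ x ++ c ∷ v) ≡ μ x ++ c ∷ not c ∷ μ x ++ c ∷ not c ∷ μ v
μ-repeat x c v = trans (μ-++ x _) (cong (λ t → μ x ++ c ∷ not c ∷ t) (μ-++ x (c ∷ v)))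

snoc-assoc : ∀ (x : Word) c y → x ++ c ∷ y ≡ (x ++ [ c ]) ++ y
snoc-assoc x c y = sym (++-assoc x [ c ] y)

shift-repeat : ∀ (x : Word) c d v → x ++ c ∷ d ∷ x ++ c ∷ v ≡ (x ++ [ c ]) ++ d ∷ (x ++ [ c ]) ++ v
shift-repeat x c d v = trans (snoc-assoc x c _) (cong (λ t → (x ++ [ c ]) ++ d ∷ t) (snoc-assoc x c v))

-- The image of `axaxa c x` begins with the overlap `axaxa c (not c ∷ μ x)`.
of-μ : OverlapFree (μ v) → OverlapFree v
of-μ of _ (u , z , refl) (c , x , refl) = overlap⇒⊥ of (μ u) c (not c ∷ μ x) (not c ∷ μ z) (begin
  μ (u ++ axaxa c x ++ z)             ≡⟨ cong (λ t → μ (u ++ t)) (axaxa-++ c x z) ⟩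
  μ (u ++ c ∷ x ++ c ∷ x ++ c ∷ z)    ≡⟨ μ-++ u _ ⟩
  μ u ++ μ (c ∷ x ++ c ∷ x ++ c ∷ z)  ≡⟨ cong (λ t → μ u ++ c ∷ not c ∷ t) (μ-repeat x c z) ⟩
  μ u ++ c ∷ not c ∷ μ x ++ c ∷ not c ∷ μ x ++ c ∷ not c ∷ μ z ∎)
  where open ≡-Reasoning

-- The letter `a` ends `μ [ not a ]`, so only the first letter of the image of `not a ∷ v` is
-- missing. For an overlap at the very start, the repetition in the image shifted one letter to the
-- right still fits, because the closing letter contributes two.
of-μ-left : OverlapFree (a ∷ μ v) → OverlapFree (not a ∷ v)
of-μ-left of f (_ ∷ u , z , eq) o = of-μ (of-tail of) f (u , z , ∷-injectiveʳ eq) o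
of-μ-left {a} {v} of _ ([] , z , eq) (c , x , refl)
  with refl , eq′ ← ∷-injective (trans eq (axaxa-++ c x z)) =
  overlap⇒⊥ of [] a (μ x ++ [ not a ]) (μ z) (cong (a ∷_) (begin
    μ v                                                   ≡⟨ cong μ eq′ ⟩
    μ (x ++ c ∷ x ++ c ∷ z)                               ≡⟨ μ-repeat x c z ⟩
    μ x ++ c ∷ not c ∷ μ x ++ c ∷ not c ∷ μ z             ≡⟨ shift-repeat (μ x) c (not c) _ ⟩
    (μ x ++ [ c ]) ++ not c ∷ (μ x ++ [ c ]) ++ not c ∷ μ z
      ≡⟨ cong (λ t → (μ x ++ [ c ]) ++ t ∷ (μ x ++ [ c ]) ++ t ∷ μ z) (not-involutive a) ⟩
    (μ x ++ [ c ]) ++ a ∷ (μ x ++ [ c ]) ++ a ∷ μ z       ∎))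
  where open ≡-Reasoning

-- Only the last letter of `μ (v ++ [ b ])` is missing. It lies in `not c ∷ μ z`, behind the overlap
-- that the image contains.
of-μ-right : OverlapFree (μ v ++ [ b ]) → OverlapFree (v ++ [ b ])
of-μ-right {v} {b} of _ (u , z , eq) (c , x , refl)
  with t , e , snoc ← snoc-view (not c) (μ z) =
  overlap⇒⊥ of (μ u) c (not c ∷ μ x) t (∷ʳ-injectiveˡ (μ v ++ [ b ]) _ (begin
    (μ v ++ [ b ]) ++ [ not b ]         ≡⟨ ++-assoc (μ v) [ b ] [ not b ] ⟩
    μ v ++ μ [ b ]                      ≡⟨ μ-++ v [ b ] ⟨
    μ (v ++ [ b ])                      ≡⟨ cong μ eq ⟩
    μ (u ++ axaxa c x ++ z)             ≡⟨ cong (λ t → μ (u ++ t)) (axaxa-++ c x z) ⟩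
    μ (u ++ c ∷ x ++ c ∷ x ++ c ∷ z)    ≡⟨ μ-++ u _ ⟩
    μ u ++ μ (c ∷ x ++ c ∷ x ++ c ∷ z)  ≡⟨ cong (λ t → μ u ++ c ∷ not c ∷ t) (μ-repeat x c z) ⟩
    μ u ++ p ++ p ++ c ∷ not c ∷ μ z    ≡⟨ cong (λ t → μ u ++ p ++ p ++ c ∷ t) snoc ⟩
    μ u ++ p ++ p ++ (c ∷ t) ++ [ e ]   ≡⟨ cong (λ t → μ u ++ p ++ t) (++-assoc p (c ∷ t) [ e ]) ⟨
    μ u ++ p ++ (p ++ c ∷ t) ++ [ e ]   ≡⟨ cong (μ u ++_) (++-assoc p (p ++ c ∷ t) [ e ]) ⟨
    μ u ++ (p ++ p ++ c ∷ t) ++ [ e ]   ≡⟨ ++-assoc (μ u) (p ++ p ++ c ∷ t) [ e ] ⟨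
    (μ u ++ p ++ p ++ c ∷ t) ++ [ e ]   ∎))
  where
    open ≡-Reasoning
    p : Word
    p = c ∷ not c ∷ μ x

-- Alignment of overlap-free words

-- Words of the form μ(v) or μ(v)c.
data Aligned : Word → Set where
  []   : Aligned []
  [-]  : Aligned [ c ]
  pair : d ≡ not c → Aligned w → Aligned (c ∷ d ∷ w)

same-or-not : ∀ c d → d ≡ c ⊎ d ≡ not c
same-or-not true  true  = inj₁ refl
same-or-not true  false = inj₂ refl
same-or-not false true  = inj₂ refl
same-or-not false false = inj₁ refl

-- A neighbour equal to `c` makes a cube of `c`; two neighbours `not c` complete an overlap of
-- period three.
¬aabaa-inside : ∀ p c r v → ¬ OverlapFree (p ∷ c ∷ c ∷ not c ∷ c ∷ c ∷ r ∷ v)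
¬aabaa-inside p c r v of with same-or-not c p | same-or-not c r
... | inj₁ refl | _         = overlap⇒⊥ of [] c [] _ refl
... | inj₂ refl | inj₁ refl = overlap⇒⊥ of (not c ∷ c ∷ c ∷ not c ∷ []) c [] v refl
... | inj₂ refl | inj₂ refl = overlap⇒⊥ of [] (not c) (c ∷ c ∷ []) v refl

-- The next double letter starts two or four places after this one: distance one is a cube, distance
-- three is excluded by `¬aabaa-inside`, and a distance beyond four leaves five alternating letters,
-- an overlap. The recursion restarts at the next double letter.
aligned-after-double : ∀ p c w q → OverlapFree (p ∷ c ∷ c ∷ w ++ [ q ]) → Aligned (c ∷ w)
aligned-after-double p c []      q of = [-]
aligned-after-double p c (d ∷ w) q of with same-or-not c d
... | inj₁ refl = ⊥-elim (overlap⇒⊥ of [ p ] c [] _ refl)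
aligned-after-double p c (_ ∷ [])    q of | inj₂ refl = pair refl []
aligned-after-double p c (_ ∷ e ∷ w) q of | inj₂ refl with same-or-not c e
... | inj₂ refl = pair refl (aligned-after-double c (not c) w q (of-suffix (p ∷ c ∷ []) of))
aligned-after-double p c (_ ∷ _ ∷ [])    q of | inj₂ refl | inj₁ refl = pair refl [-]
aligned-after-double p c (_ ∷ _ ∷ f ∷ w) q of | inj₂ refl | inj₁ refl with same-or-not c f
aligned-after-double p c (_ ∷ _ ∷ _ ∷ [])    q of | inj₂ refl | inj₁ refl | inj₁ refl =
  ⊥-elim (¬aabaa-inside p c q [] of)
aligned-after-double p c (_ ∷ _ ∷ _ ∷ r ∷ w) q of | inj₂ refl | inj₁ refl | inj₁ refl =
  ⊥-elim (¬aabaa-inside p c r (w ++ [ q ]) of)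
aligned-after-double p c (_ ∷ _ ∷ _ ∷ [])    q of | inj₂ refl | inj₁ refl | inj₂ refl =
  pair refl (pair refl [])
aligned-after-double p c (_ ∷ _ ∷ _ ∷ g ∷ w) q of | inj₂ refl | inj₁ refl | inj₂ refl with same-or-not c g
... | inj₁ refl = ⊥-elim (overlap⇒⊥ of (p ∷ c ∷ []) c [ not c ] _ refl)
... | inj₂ refl = pair refl (pair refl
  (aligned-after-double c (not c) w q (of-suffix (p ∷ c ∷ c ∷ not c ∷ []) of)))

-- The parity of the place of the first double letter decides. Five alternating letters form an
-- overlap, so that place is among the first four; shorter alternating words are aligned.
aligned-or-shifted : ∀ p w q → OverlapFree (p ∷ w ++ [ q ]) → Aligned w ⊎ Aligned (drop 1 w)
aligned-or-shifted p []          q of = inj₁ []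
aligned-or-shifted p (c ∷ [])    q of = inj₁ [-]
aligned-or-shifted p (c ∷ d ∷ w) q of with same-or-not c d
... | inj₁ refl = inj₂ (aligned-after-double p c w q of)
aligned-or-shifted p (c ∷ _ ∷ [])    q of | inj₂ refl = inj₁ (pair refl [])
aligned-or-shifted p (c ∷ _ ∷ e ∷ w) q of | inj₂ refl with same-or-not c e
... | inj₂ refl = inj₁ (pair refl (aligned-after-double c (not c) w q (of-tail of)))
aligned-or-shifted p (c ∷ _ ∷ _ ∷ [])    q of | inj₂ refl | inj₁ refl = inj₁ (pair refl [-])
aligned-or-shifted p (c ∷ _ ∷ _ ∷ f ∷ w) q of | inj₂ refl | inj₁ refl with same-or-not c f
... | inj₁ refl = inj₂ (pair (sym (not-involutive c))
  (aligned-after-double (not c) c w q (of-suffix (p ∷ c ∷ []) of)))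
aligned-or-shifted p (c ∷ _ ∷ _ ∷ _ ∷ [])    q of | inj₂ refl | inj₁ refl | inj₂ refl =
  inj₁ (pair refl (pair refl []))
aligned-or-shifted p (c ∷ _ ∷ _ ∷ _ ∷ g ∷ w) q of | inj₂ refl | inj₁ refl | inj₂ refl with same-or-not c g
... | inj₁ refl = ⊥-elim (overlap⇒⊥ of [ p ] c [ not c ] _ refl)
... | inj₂ refl = inj₁ (pair refl (pair refl
  (aligned-after-double c (not c) w q (of-suffix (p ∷ c ∷ not c ∷ []) of))))

aligned-++⁻ : Even x → Aligned (x ++ y) → Aligned x × Aligned y
aligned-++⁻ []     al           = [] , al
aligned-++⁻ (2+ p) (pair eq al) with alˣ , alʸ ← aligned-++⁻ p al = pair eq alˣ , alʸ

aligned-odd-++⁻ : Even x → Aligned (c ∷ x ++ d ∷ y) → Aligned (c ∷ x ++ [ d ]) × Aligned y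
aligned-odd-++⁻ []     (pair eq al) = pair eq [] , al
aligned-odd-++⁻ (2+ p) (pair eq al) with alˣ , alʸ ← aligned-odd-++⁻ p al = pair eq alˣ , alʸ

-- Squares at aligned positions

-- Both alignments together make `c ∷ x ++ [ c ]` alternate, but an alternating word of even length
-- ends in a different letter than it starts with.
¬aligned-both : Even x → Aligned x → ¬ Aligned (c ∷ x ++ [ c ])
¬aligned-both {c = true}  [] _ (pair () _)
¬aligned-both {c = false} [] _ (pair () _)
¬aligned-both {c = c} (2+ p) (pair refl al) (pair refl al′) rewrite not-involutive c = ¬aligned-both p al al′

aligned⇒μ : Even x → Aligned x → ∃[ y ] x ≡ μ y
aligned⇒μ []     []             = [] , refl
aligned⇒μ (2+ p) (pair refl al) with y , refl ← aligned⇒μ p al = _ ∷ y , refl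

-- The two copies of an odd root would sit on opposite parities, against `¬aligned-both`. Hence the
-- root is even and is itself an image.
desubstitute-square : ∀ x → Aligned ((x ++ x) ++ w) → (∃[ y ] x ≡ μ y) × Aligned w
desubstitute-square {w} x al with parity x
... | even p with alˣˣ , alʷ ← aligned-++⁻ (even-xx x) al = aligned⇒μ p (proj₁ (aligned-++⁻ p alˣˣ)) , alʷ
... | odd p with alˡ , alʳ ← aligned-odd-++⁻ p (subst Aligned (++-assoc x x w) al) =
  ⊥-elim (¬aligned-both p (proj₁ (aligned-++⁻ p alʳ)) alˡ)

desubstitute : All Square ss → Aligned (concat ss) →
  ∃[ ts ] All Square ts × length ts ≡ length ss × concat ss ≡ μ (concat ts)
desubstitute [] al = [] , [] , refl , refl
desubstitute {_ ∷ ss} ((x , x≢[] , refl) ∷ sqs) al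
  with (y , refl) , al′ ← desubstitute-square x al
  with ts , sqs′ , len , eq ← desubstitute sqs al′ =
  (y ++ y) ∷ ts ,
  (y , (λ { refl → x≢[] refl }) , refl) ∷ sqs′ ,
  cong suc len ,
  (begin
    (μ y ++ μ y) ++ concat ss    ≡⟨ cong₂ _++_ (sym (μ-++ y y)) eq ⟩
    μ (y ++ y) ++ μ (concat ts)  ≡⟨ μ-++ (y ++ y) _ ⟨
    μ ((y ++ y) ++ concat ts)    ∎)
  where open ≡-Reasoning

-- Squares at shifted positions

data Block : Word → Set where
  short : ∀ c → Block (c ∷ c ∷ [])
  long  : ∀ c → Block (c ∷ not c ∷ c ∷ c ∷ not c ∷ c ∷ [])

-- The two copies of the root sit on opposite parities, so the root alternates; from length five on
-- it starts with an overlap, which leaves lengths one and three. The `c` kept before `w` is the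
-- last letter of the square, ready for the next one.
odd-shifted-square : ∀ c → Even x → OverlapFree (c ∷ x ++ c ∷ x ++ w) → Aligned (x ++ c ∷ x ++ w) →
  Block (c ∷ x ++ c ∷ x) × OverlapFree (c ∷ w) × Aligned (c ∷ w)
odd-shifted-square c [] of al = short c , of-tail of , al
odd-shifted-square c (2+ p) of al with aligned-++⁻ (2+ p) al
odd-shifted-square c (2+ p) of al | pair refl alˣ , pair refl al′ rewrite not-involutive c
  with p | alˣ | al′
... | [] | [] | _ with pair _ (pair _ al″) ← al =
  long c , of-suffix (c ∷ not c ∷ c ∷ c ∷ not c ∷ []) of , al″
... | 2+ _ | pair refl _ | pair refl _ rewrite not-involutive c =
  ⊥-elim (overlap⇒⊥ of [] c [ not c ] _ refl)

-- The last letter of `c ∷ x` opens a pair, which fixes the letter after it.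
aligned-next-unique : Even x → Aligned (c ∷ x ++ d ∷ y) → Aligned (c ∷ x ++ e ∷ z) → d ≡ e
aligned-next-unique []     (pair refl _) (pair refl _) = refl
aligned-next-unique (2+ p) (pair _ al)   (pair _ al′)  = aligned-next-unique p al al′

-- At a shifted position the alternating pairs force the letter after xx, |x| even, to be the first letter of x …
¬even-shifted-square-then : Even (c ∷ x) → Aligned (x ++ c ∷ x ++ d ∷ w) →
  ¬ OverlapFree (c ∷ x ++ c ∷ x ++ d ∷ w)
¬even-shifted-square-then {c} {_ ∷ x} {d} {w} (2+ p) al of
  with refl ← aligned-next-unique p al (proj₂ (aligned-odd-++⁻ p al)) =
  overlap⇒⊥ of [] c (_ ∷ x) w refl

aligned-last : Even x → Aligned (d ∷ x ++ c ∷ w) → ∃[ y ] d ∷ x ≡ y ++ [ not c ]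
aligned-last {d = d} [] (pair refl _) = [] , cong [_] (sym (not-involutive d))
aligned-last {f ∷ _} {d} (2+ p) (pair _ al) with y , eq ← aligned-last p al =
  d ∷ f ∷ y , cong (λ t → d ∷ f ∷ t) eq

-- … and the letter before xx to be the last letter of x.
¬even-shifted-square-after : Even (c ∷ x) → Aligned (e ∷ c ∷ x ++ c ∷ z) →
  ¬ OverlapFree (e ∷ c ∷ x ++ c ∷ x ++ w)
¬even-shifted-square-after {x = x} {e = e} {w = w} (2+ p) (pair refl al) of
  with y , eq ← aligned-last p al = overlap⇒⊥ of [] e (not e ∷ y) w (cong (λ t → e ∷ not e ∷ t) (begin
    x ++ not e ∷ x ++ w
      ≡⟨ cong (λ t → t ++ not e ∷ t ++ w) (trans eq (cong (λ t → y ++ [ t ]) (not-involutive e))) ⟩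
    (y ++ [ e ]) ++ not e ∷ (y ++ [ e ]) ++ w
      ≡⟨ shift-repeat y e (not e) w ⟨
    y ++ e ∷ not e ∷ y ++ e ∷ w ∎))
  where open ≡-Reasoning

-- Here `e` stands for the last letter of the preceding square; it excludes even roots.
blocks-after : All Square ss → OverlapFree (e ∷ concat ss) → Aligned (e ∷ concat ss) → All Block ss
blocks-after [] _ _ = []
blocks-after (([] , x≢[] , refl) ∷ sqs) _ _ = ⊥-elim (x≢[] refl)
blocks-after {_ ∷ ss} ((c ∷ x , _ , refl) ∷ sqs) of al
  rewrite ++-assoc x (c ∷ x) (concat ss) with parity (c ∷ x)
... | even p = ⊥-elim (¬even-shifted-square-after p al of)
... | odd p with pair _ al′ ← al
  with block , of′ , al″ ← odd-shifted-square c p (of-tail of) al′ =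
  block ∷ blocks-after sqs of′ al″

-- No letter is given before the first square, so its even roots are excluded by the letter after
-- it, which a second square supplies.
blocks : 2 ≤ length ss → All Square ss → OverlapFree (concat ss) → Aligned (drop 1 (concat ss)) → All Block ss
blocks _ (([] , x≢[] , refl) ∷ sqs) _ _ = ⊥-elim (x≢[] refl)
blocks _ (_ ∷ ([] , y≢[] , refl) ∷ sqs) _ _ = ⊥-elim (y≢[] refl)
blocks (s≤s ()) (_ ∷ [])
blocks {_ ∷ ss} _ ((c ∷ x , _ , refl) ∷ sqs@((d ∷ y , _ , refl) ∷ _)) of al
  rewrite ++-assoc x (c ∷ x) (concat ss) with parity (c ∷ x)
... | even p = ⊥-elim (¬even-shifted-square-then p al of)
... | odd p with block , of′ , al′ ← odd-shifted-square c p of al =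
  block ∷ blocks-after sqs of′ al′

-- The finite search

-- An overlap at the head is determined by the length `n` of its `x`. It fits when `2n + 3` is at
-- most `1 + length w`, that is, for `n` below `⌊ length w /2⌋`.
HasOverlap : Word → Set
HasOverlap []      = ⊥
HasOverlap (a ∷ w) = Any (λ n → Prefix _≡_ (axaxa a (take n w)) (a ∷ w)) (upTo ⌊ length w /2⌋) ⊎ HasOverlap w

hasOverlap? : ∀ w → Dec (HasOverlap w)
hasOverlap? []      = no λ ()
hasOverlap? (a ∷ w) = any? (λ n → prefix? _≟ᵇ_ (axaxa a (take n w)) (a ∷ w)) (upTo ⌊ length w /2⌋) ⊎-dec hasOverlap? w

prefix⇒++ : Prefix _≡_ x w → ∃[ v ] w ≡ x ++ v
prefix⇒++ pre with toView pre
... | eqs ++ᵖ v = v , cong (_++ v) (sym (Pointwise-≡⇒≡ eqs))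

overlapFree⇒¬hasOverlap : OverlapFree w → ¬ HasOverlap w
overlapFree⇒¬hasOverlap {_ ∷ _} of (inj₂ h) = overlapFree⇒¬hasOverlap (of-tail of) h
overlapFree⇒¬hasOverlap {a ∷ w} of (inj₁ h) with n , pre ← satisfied h with v , eq ← prefix⇒++ pre =
  of _ ([] , v , eq) (a , take n w , refl)

blockList : List Word
blockList = (false ∷ false ∷ []) ∷ (true ∷ true ∷ []) ∷
  (false ∷ true ∷ false ∷ false ∷ true ∷ false ∷ []) ∷
  (true ∷ false ∷ true ∷ true ∷ false ∷ true ∷ []) ∷ []

block∈ : Block x → x ∈ blockList
block∈ (short false) = here refl
block∈ (short true)  = there (here refl)
block∈ (long false)  = there (there (here refl))
block∈ (long true)   = there (there (there (here refl)))

-- The single letter at the end is the right extension. Blocks are prepended, so every stage prunes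
-- by the suffixes already found.
blockWords : ℕ → List Word
blockWords zero    = [ true ] ∷ [ false ] ∷ []
blockWords (suc n) = filter (¬? ∘ hasOverlap?) (cartesianProductWith _++_ blockList (blockWords n))

∈-blockWords : ∀ b → All Block ss → OverlapFree (concat ss ++ [ b ]) → concat ss ++ [ b ] ∈ blockWords (length ss)
∈-blockWords true  [] _ = here refl
∈-blockWords false [] _ = there (here refl)
∈-blockWords {s ∷ ss} b (block ∷ bs) of rewrite ++-assoc s (concat ss) [ b ] =
  ∈-filter⁺ (¬? ∘ hasOverlap?)
    (∈-cartesianProductWith⁺ _++_ (block∈ block) (∈-blockWords b bs (of-suffix s of)))
    (overlapFree⇒¬hasOverlap of)

blockWords-8+ : ∀ n → blockWords (n + 8) ≡ []
-- The search runs here, by evaluation: nothing with eight blocks survives the filter.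
blockWords-8+ zero    = refl
blockWords-8+ (suc n) rewrite blockWords-8+ n = refl

blocks<8 : All Block ss → OverlapFree (concat ss ++ [ b ]) → length ss < 8
blocks<8 {ss} {b} bs of with 8 ≤? length ss
... | no ≱8 = ≰⇒> ≱8
... | yes ≥8 with subst (λ n → concat ss ++ [ b ] ∈ blockWords n) (sym (m∸n+n≡m ≥8)) (∈-blockWords b bs of)
... | mem rewrite blockWords-8+ (length ss ∸ 8) with () ← mem

-- Descent along the morphism

length-μ : ∀ v → length v ≤ length (μ v)
length-μ []      = z≤n
length-μ (c ∷ v) = s≤s (m≤n⇒m≤1+n (length-μ v))

μ-longer : 1 ≤ length ss → All Square ss → length (concat ss) < length (μ (concat ss))
μ-longer _ (([] , x≢[] , refl) ∷ _) = ⊥-elim (x≢[] refl)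
μ-longer {_ ∷ ss} _ ((c ∷ x , _ , refl) ∷ _) = s≤s (s≤s (length-μ ((x ++ c ∷ x) ++ concat ss)))

-- Each one-sided extension passes through `μ` on its own, and `of-extend` joins the two at every
-- stage. The bound `n` on the total length drives the recursion, as the preimages `ts` are not a
-- subterm of `ss`.
extendable<8 : All Square ss → OverlapFree (a ∷ concat ss) → OverlapFree (concat ss ++ [ b ]) → length ss < 8
extendable<8 = go _ ≤-refl
  where
  go : ∀ n → length (concat ss) < n → All Square ss →
    OverlapFree (a ∷ concat ss) → OverlapFree (concat ss ++ [ b ]) → length ss < 8
  go {ss} {a} {b} (suc n) (s≤s len≤n) sqs ofˡ ofʳ with 2 ≤? length ss
  ... | no ≱2 = ≤-trans (≰⇒> ≱2) (s≤s (s≤s z≤n))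
  ... | yes ≥2 with aligned-or-shifted a (concat ss) b (of-extend (even-concat sqs) ofˡ ofʳ)
  ...   | inj₂ al = blocks<8 (blocks ≥2 sqs (of-tail ofˡ) al) ofʳ
  ...   | inj₁ al with ts , sqs′ , len , eq ← desubstitute sqs al rewrite eq | sym len =
    go n (≤-trans (μ-longer (≤-trans (s≤s z≤n) ≥2) sqs′) len≤n) sqs′ (of-μ-left ofˡ) (of-μ-right ofʳ)

-- Squares at the ends as extensions

of-after-square : Square x → OverlapFree (x ++ w) → ∃[ a ] OverlapFree (a ∷ w)
of-after-square ([] , x≢[] , refl) of = ⊥-elim (x≢[] refl)
of-after-square {w = w} (c ∷ x , _ , refl) of with t , e , eq ← snoc-view c (x ++ c ∷ x) =
  -- The witness is the last letter of the square.
  e , of-suffix t (subst OverlapFree (trans (cong (_++ w) eq) (++-assoc t [ e ] w)) of)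

of-before-square : Square x → OverlapFree (w ++ x) → ∃[ b ] OverlapFree (w ++ [ b ])
of-before-square ([] , x≢[] , refl) of = ⊥-elim (x≢[] refl)
of-before-square {w = w} (c ∷ x , _ , refl) of =
  c , of-prefix (w ++ [ c ]) (subst OverlapFree (snoc-assoc w c _) of)

concat-∷ʳ : ∀ ss (s : Word) → concat (ss ∷ʳ s) ≡ concat ss ++ s
concat-∷ʳ ss s = trans (sym (concat-++ ss [ s ])) (cong (concat ss ++_) (++-identityʳ s))

-- Giving up the last square buys a right extension for the rest, namely the first letter of that
-- square.
leftExtendable<9 : All Square ss → OverlapFree (a ∷ concat ss) → length ss < 9
leftExtendable<9 {ss} {a} sqs of with initLast ss
... | [] = s≤s z≤n
... | ts ∷ʳ′ s rewrite concat-∷ʳ ts s | length-++ ts {[ s ]} | +-comm (length ts) 1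
  with sqs′ , sq ← ∷ʳ⁻ sqs with b , ofʳ ← of-before-square sq (of-tail of) =
  s≤s (extendable<8 sqs′ (of-prefix (a ∷ concat ts) of) ofʳ)

rightExtendable<9 : All Square ss → OverlapFree (concat ss ++ [ b ]) → length ss < 9
rightExtendable<9 [] _ = s≤s z≤n
rightExtendable<9 {s ∷ ss} {b} (sq ∷ sqs) of rewrite ++-assoc s (concat ss) [ b ]
  with a , ofˡ ← of-after-square sq of =
  s≤s (extendable<8 sqs (of-prefix (a ∷ concat ss) ofˡ) (of-tail ofˡ))

squares<10 : All Square ss → OverlapFree (concat ss) → length ss < 10
squares<10 [] _ = s≤s z≤n
squares<10 (sq ∷ sqs) of with a , ofˡ ← of-after-square sq of = s≤s (leftExtendable<9 sqs ofˡ)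

theorem8 : (w : Word) → OverlapFree w →
    (ss : List Word) → All Square ss → concat ss ≡ w →
    (l r : ℕ) → HasL w l → HasR w r →
    length ss + l + r ≤ 9
-- Each extension adds one to the sum and lowers the bound on the number of squares by one, so all
-- four cases give nine.
theorem8 w of ss sqs refl _ _ (L-one (_ , ofˡ)) (R-one (_ , ofʳ)) =
  +-monoˡ-≤ 1 (+-monoˡ-≤ 1 (≤-pred (extendable<8 sqs ofˡ ofʳ)))
theorem8 w of ss sqs refl _ _ (L-one (_ , ofˡ)) (R-zero _) =
  +-monoˡ-≤ 0 (+-monoˡ-≤ 1 (≤-pred (leftExtendable<9 sqs ofˡ)))
theorem8 w of ss sqs refl _ _ (L-zero _) (R-one (_ , ofʳ)) =
  +-monoˡ-≤ 1 (+-monoˡ-≤ 0 (≤-pred (rightExtendable<9 sqs ofʳ)))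
theorem8 w of ss sqs refl _ _ (L-zero _) (R-zero _) =
  +-monoˡ-≤ 0 (+-monoˡ-≤ 0 (≤-pred (squares<10 sqs of)))
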